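{- The following problem, parameterized by the number $k=|S|$ of steps, is fixed-parameter tractable (FPT): given a constrained workflow specification $((S,E),U,A,C)$ in which all constraints have the form $(=,S_1,S_2)$ or $(\neq,S_1,S_2)$ with $S_1,S_2\subseteq S$, determine whether there exists a plan $\alpha:S\to U$ that violates the workflow specification, that is, such that $(s,\alpha(s))\in A$ for all $s\in S$ and at least one constraint in $C$ is not satisfied by $\alpha$.
   Context: A constrained workflow specification is a tuple $((S,E),U,A,C)$, where $(S,E)$ is a directed acyclic graph on a set $S$ of steps, $U$ is a set of users, $A\subseteq S\times U$ is an authorization policy (for every $s\in S$ there is some $u\in U$ with $(s,u)\in A$), and $C$ is a set of constraints $(\rho,S_1,S_2)$ with $\rho\subseteq U\times U$ and $S_1,S_2\subseteq S$. A plan is a function $\alpha:S\to U$; it satisfies $(\rho,S_1,S_2)$ if there exist $s_1\in S_1$ and $s_2\in S_2$ with $(\alpha(s_1),\alpha(s_2))\in\rho$. The symbol $=$ denotes the diagonal relation $\{(u,u):u\in U\}$ and $\neq$ denotes its complement in $U\times U$. A problem with parameter $k$ is FPT if it can be solved by an algorithm running in time $O(f(k)N^d)$, where $N$ is the size of the input, $f$ is a function of $k$ only, and $d$ is a constant independent of $k$ and $N$. -}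

module Defs where

open import Data.Bool.Base using (Bool; true; false)
open import Data.Fin.Base using (Fin)
open import Data.Fin.Subset using (Subset; _∈_; Nonempty; ∁; ⁅_⁆)
open import Data.List.Base as List using (List; []; _∷_)
open import Data.List.Relation.Unary.All using (All; []; _∷_)
open import Data.List.Relation.Unary.Any using (Any)
open import Data.Nat.Base using (ℕ; suc; _+_; _*_; _^_; _≤_)
open import Data.Product.Base using (Σ-syntax; ∃-syntax; _×_; _,_)
open import Data.Sum.Base using (_⊎_; inj₁; inj₂)
open import Data.Vec.Base as Vec using (Vec; []; _∷_; lookup)
open import Function.Bundles using (_⇔_)
open import Relation.Binary.Construct.Closure.Transitive using (TransClosure)
open import Relation.Binary.PropositionalEquality.Core using (_≡_; refl)
open import Relation.Nullary.Negation.Core using (¬_)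

------------------------------------------------------------------------
-- Workflow specifications

-- A relation between finite sets, given as the row of relatives of
-- each element of the first set.

FinRel : ℕ → ℕ → Set
FinRel m n = Vec (Subset n) m

infix 4 _⟪_⟫_

_⟪_⟫_ : ∀ {m n} → Fin m → FinRel m n → Fin n → Set
i ⟪ R ⟫ j = j ∈ lookup R i

Diagonal : ∀ n → FinRel n n
Diagonal n = Vec.tabulate ⁅_⁆

Complement : ∀ {m n} → FinRel m n → FinRel m n
Complement = Vec.map ∁

Acyclic : ∀ {k} → FinRel k k → Set
Acyclic E = ∀ s → ¬ TransClosure (λ x y → x ⟪ E ⟫ y) s s

record Constraint (k n : ℕ) : Set where
  constructor ⟨_,_,_⟩
  field
    ρ  : FinRel n n
    S₁ : Subset k
    S₂ : Subset k

-- The step set is Fin steps and the user set is Fin users.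

record Specification : Set where
  field
    steps       : ℕ
    users       : ℕ
    E           : FinRel steps steps
    acyclic     : Acyclic E
    A           : FinRel steps users
    authorized  : ∀ s → Nonempty (lookup A s)
    constraints : List (Constraint steps users)

Plan : ℕ → ℕ → Set
Plan k n = Fin k → Fin n

Satisfies : ∀ {k n} → Plan k n → Constraint k n → Set
Satisfies α ⟨ ρ , S₁ , S₂ ⟩ =
  ∃[ s₁ ] ∃[ s₂ ] (s₁ ∈ S₁ × s₂ ∈ S₂ × α s₁ ⟪ ρ ⟫ α s₂)

module _ (W : Specification) where
  open Specification W

  Violates : Plan steps users → Set
  Violates α =
    (∀ s → s ⟪ A ⟫ α s) × Any (λ c → ¬ Satisfies α c) constraints

EqualityOrInequality : ∀ {k n} → Constraint k n → Set
EqualityOrInequality {n = n} c =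
  Constraint.ρ c ≡ Diagonal n ⊎ Constraint.ρ c ≡ Complement (Diagonal n)

record EqualitySpecification : Set where
  field
    specification : Specification
  open Specification specification public
  field
    restricted : All EqualityOrInequality constraints

------------------------------------------------------------------------
-- Encoding of inputs as binary trees

data Tree : Set where
  leaf : Tree
  node : Tree → Tree → Tree

size : Tree → ℕ
size leaf       = 1
size (node l r) = suc (size l + size r)

encodeBool : Bool → Tree
encodeBool false = leaf
encodeBool true  = node leaf leaf

encodeList : List Tree → Tree
encodeList = List.foldr node leaf

-- A finite set contributes its cardinality to the size of the input, as
-- its elements are listed; hence the unary notation.

encodeFinite : ℕ → Tree
encodeFinite n = encodeList (List.replicate n leaf)

encodeSubset : ∀ {n} → Subset n → Tree
encodeSubset p = encodeList (List.map encodeBool (Vec.toList p))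

encodeRel : ∀ {m n} → FinRel m n → Tree
encodeRel R = encodeList (List.map encodeSubset (Vec.toList R))

-- The relation of a constraint is written as one of two symbols, "="
-- being encoded as true and "≠" as false.

encodeConstraint : ∀ {k n} (c : Constraint k n) → EqualityOrInequality c → Tree
encodeConstraint ⟨ _ , S₁ , S₂ ⟩ form =
  node (symbol form) (node (encodeSubset S₁) (encodeSubset S₂))
  where
  symbol : ∀ {P Q : Set} → P ⊎ Q → Tree
  symbol (inj₁ _) = encodeBool true
  symbol (inj₂ _) = encodeBool false

encodeConstraints : ∀ {k n} {cs : List (Constraint k n)} →
                    All EqualityOrInequality cs → Tree
encodeConstraints []                     = leaf
encodeConstraints (_∷_ {x = c} form forms) =
  node (encodeConstraint c form) (encodeConstraints forms)

encodeSpecification : EqualitySpecification → Tree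
encodeSpecification W =
  node (node (encodeFinite steps) (encodeRel E))
    (node (encodeFinite users)
      (node (encodeRel A) (encodeConstraints restricted)))
  where open EqualitySpecification W

------------------------------------------------------------------------
-- Algorithms and their running time

-- Algorithms are terms of the untyped call-by-value λ-calculus over
-- binary trees, with recursive functions.  Time is the number of rule
-- instances in the evaluation derivation.  For a fixed term, a machine
-- that shares trees and environments by pointers performs every rule in
-- constantly many memory operations, so this measure agrees with
-- Turing-machine time up to a polynomial.

-- Term n has n free variables (de Bruijn indices).  In fix b, index 0 of
-- b is the argument and index 1 the function itself; in case t a b,
-- indices 0 and 1 of b are the left and the right subtree.

data Term (n : ℕ) : Set where
  var  : Fin n → Term n
  fix  : Term (2 + n) → Term n
  app  : Term n → Term n → Term n
  leaf : Term n
  node : Term n → Term n → Term n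
  case : Term n → Term n → Term (2 + n) → Term n

data Value : Set where
  leaf    : Value
  node    : Value → Value → Value
  closure : ∀ {n} → Term (2 + n) → Vec Value n → Value

Env : ℕ → Set
Env = Vec Value

infix 4 _⊢_⇓_[_]

data _⊢_⇓_[_] {n} (ρ : Env n) : Term n → Value → ℕ → Set where

  var  : ∀ {i} → ρ ⊢ var i ⇓ lookup ρ i [ 1 ]

  fix  : ∀ {b} → ρ ⊢ fix b ⇓ closure b ρ [ 1 ]

  app  : ∀ {t u m b v w i j l} {σ : Env m} →
         ρ ⊢ t ⇓ closure b σ [ i ] →
         ρ ⊢ u ⇓ v [ j ] →
         v ∷ closure b σ ∷ σ ⊢ b ⇓ w [ l ] →
         ρ ⊢ app t u ⇓ w [ suc (i + j + l) ]

  leaf : ρ ⊢ leaf ⇓ leaf [ 1 ]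

  node : ∀ {t u v w i j} →
         ρ ⊢ t ⇓ v [ i ] →
         ρ ⊢ u ⇓ w [ j ] →
         ρ ⊢ node t u ⇓ node v w [ suc (i + j) ]

  case-leaf : ∀ {t a b w i j} →
         ρ ⊢ t ⇓ leaf [ i ] →
         ρ ⊢ a ⇓ w [ j ] →
         ρ ⊢ case t a b ⇓ w [ suc (i + j) ]

  case-node : ∀ {t a b u v w i j} →
         ρ ⊢ t ⇓ node u v [ i ] →
         u ∷ v ∷ ρ ⊢ b ⇓ w [ j ] →
         ρ ⊢ case t a b ⇓ w [ suc (i + j) ]

deterministic : ∀ {n} {ρ : Env n} {t v w i j} →
                ρ ⊢ t ⇓ v [ i ] → ρ ⊢ t ⇓ w [ j ] → v ≡ w × i ≡ j
deterministic var var = refl , refl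
deterministic fix fix = refl , refl
deterministic (app d e f) (app d′ e′ f′)
  with refl , refl ← deterministic d d′
  with refl , refl ← deterministic e e′
  with refl , refl ← deterministic f f′ = refl , refl
deterministic leaf leaf = refl , refl
deterministic (node d e) (node d′ e′)
  with refl , refl ← deterministic d d′
  with refl , refl ← deterministic e e′ = refl , refl
deterministic (case-leaf d e) (case-leaf d′ e′)
  with refl , refl ← deterministic d d′
  with refl , refl ← deterministic e e′ = refl , refl
deterministic (case-leaf d e) (case-node d′ e′)
  with () , _ ← deterministic d d′
deterministic (case-node d e) (case-leaf d′ e′)
  with () , _ ← deterministic d d′
deterministic (case-node d e) (case-node d′ e′)
  with refl , refl ← deterministic d d′
  with refl , refl ← deterministic e e′ = refl , refl

value : Tree → Value
value leaf       = leaf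
value (node l r) = node (value l) (value r)

-- The only variable of an algorithm is its input.

Algorithm : Set
Algorithm = Term 1

infix 4 _on_outputs_within_

_on_outputs_within_ : Algorithm → Tree → Bool → ℕ → Set
p on x outputs b within T =
  ∃[ t ] (t ≤ T × value x ∷ [] ⊢ p ⇓ value (encodeBool b) [ t ])

------------------------------------------------------------------------
-- Fixed-parameter tractability

record ParameterizedProblem : Set₁ where
  field
    Instance  : Set
    encode    : Instance → Tree
    parameter : Instance → ℕ
    Yes       : Instance → Set

FPT : ParameterizedProblem → Set
FPT P =
  Σ[ p ∈ Algorithm ] Σ[ f ∈ (ℕ → ℕ) ] ∃[ c ] ∃[ d ]
    ∀ (x : Instance) → Σ[ b ∈ Bool ]
      (p on encode x outputs b
         within c * (f (parameter x) * size (encode x) ^ d)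
       × (b ≡ true ⇔ Yes x))
  where open ParameterizedProblem P

ViolatingPlan : ParameterizedProblem
ViolatingPlan = record
  { Instance  = EqualitySpecification
  ; encode    = encodeSpecification
  ; parameter = EqualitySpecification.steps
  ; Yes       = λ W → ∃[ α ] Violates (EqualitySpecification.specification W) α
  }

{-# OPTIONS --safe #-}
module Submission where

open import Data.Bool.Base using (Bool; true; false; if_then_else_; not; _∧_; _∨_)
open import Data.Bool.Properties using (not-¬; ¬-not; ∨-zeroʳ)
open import Data.Empty using (⊥)
open import Data.Fin using (#_)
open import Data.Fin.Base using (Fin; zero; suc; _↑ʳ_)
open import Data.Fin.Properties using (any?; _≟_)
open import Data.Fin.Subset using (Subset; _∈_; _∉_; Nonempty; ⁅_⁆; ∁)
open import Data.Fin.Subset.Properties using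
  (_∈?_; nonempty?; x∈⁅x⁆; x∈⁅y⁆⇒x≡y; x∈∁p⇒x∉p; x∉p⇒x∈∁p)
open import Data.List.Base as List using (List; []; _∷_; length; null)
open import Data.List.Relation.Unary.All as All using (All; []; _∷_)
open import Data.List.Relation.Unary.Any as Any using (Any; here; there)
open import Data.Nat.Base using (ℕ; zero; suc; _+_; _*_; _^_; _≤_; _<_; z≤n; s≤s)
open import Data.Nat.Properties using
  (≤-trans; ≤-refl; ≤-reflexive; +-mono-≤; +-monoˡ-≤; +-monoʳ-≤; *-mono-≤;
   *-monoˡ-≤; *-monoʳ-≤; ^-monoʳ-≤; m≤m+n; m≤n+m; m≤n⇒m≤1+n; m≤m*n; m≤n*m;
   m^n≢0; *-suc; *-distribˡ-+; +-identityʳ; module ≤-Reasoning)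
open import Data.Nat.Tactic.RingSolver using (solve-∀)
open import Data.Product.Base using (∃-syntax; _×_; _,_; proj₁; proj₂)
open import Data.Sum.Base using (_⊎_; inj₁; inj₂)
open import Data.Vec.Base as Vec using (Vec; []; _∷_; lookup)
open import Data.Vec.Properties using
  (map-∘; ∷-injective; length-toList; lookup-map; lookup∘tabulate; []=⇒lookup;
   lookup⇒[]=)
open import Function.Base using (_∘_; _$_; const)
open import Function.Bundles using (_⇔_; mk⇔; Equivalence)
open import Relation.Binary.PropositionalEquality using (_≡_; refl; sym; trans; cong; subst)
open import Relation.Nullary.Decidable.Core using (Dec; yes; no; does; _×-dec_; decidable-stable)
open import Relation.Nullary.Negation using (¬_; contradiction)

open import Defs

-- A constraint (≠, S₁, S₂) is violated by some plan iff S₁ or S₂ is empty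
-- or some user is authorized for all of S₁ ∪ S₂.  A constraint (=, S₁, S₂)
-- is violated iff the users can be labelled so that every step has an
-- authorized user whose label it accepts: steps of S₁ reject the label
-- true and steps of S₂ the label false.  Labels are chosen user by user,
-- keeping only the steps not yet covered.  Both labels need to be tried
-- only if each of them covers a step, and then both branches have fewer
-- steps left; so there are at most 2 ^ k branches.

private variable
  k m n : ℕ

-- Evaluation with an upper bound on the time

boolean : Bool → Value
boolean b = value (encodeBool b)

encodeRows : List (Vec Bool n) → Tree
encodeRows = encodeList ∘ List.map encodeSubset

rows : List (Vec Bool n) → Value
rows = value ∘ encodeRows

infix 4 _⊢_⇓_within_

_⊢_⇓_within_ : Env n → Term n → Value → ℕ → Set
ρ ⊢ t ⇓ v within T = ∃[ i ] (i ≤ T × ρ ⊢ t ⇓ v [ i ])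

module _ {ρ : Env n} where

  relax : ∀ {t v S T} → S ≤ T → ρ ⊢ t ⇓ v within S → ρ ⊢ t ⇓ v within T
  relax S≤T (_ , i≤S , d) = _ , ≤-trans i≤S S≤T , d

  ⇓var : ∀ {i} → ρ ⊢ var i ⇓ lookup ρ i within 1
  ⇓var = 1 , ≤-refl , var

  ⇓var-≡ : ∀ {i v} → lookup ρ i ≡ v → ρ ⊢ var i ⇓ v within 1
  ⇓var-≡ refl = ⇓var

  ⇓fix : ∀ {b} → ρ ⊢ fix b ⇓ closure b ρ within 1
  ⇓fix = 1 , ≤-refl , fix

  ⇓leaf : ρ ⊢ leaf ⇓ leaf within 1
  ⇓leaf = 1 , ≤-refl , leaf

  ⇓node : ∀ {t u v w S T} → ρ ⊢ t ⇓ v within S → ρ ⊢ u ⇓ w within T →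
          ρ ⊢ node t u ⇓ node v w within suc (S + T)
  ⇓node (_ , i≤S , d) (_ , j≤T , e) = _ , s≤s (+-mono-≤ i≤S j≤T) , node d e

  ⇓app : ∀ {t u b v w S T U} {σ : Env m} →
         ρ ⊢ t ⇓ closure b σ within S → ρ ⊢ u ⇓ v within T →
         v ∷ closure b σ ∷ σ ⊢ b ⇓ w within U →
         ρ ⊢ app t u ⇓ w within suc (S + T + U)
  ⇓app (_ , i≤S , d) (_ , j≤T , e) (_ , l≤U , f) =
    _ , s≤s (+-mono-≤ (+-mono-≤ i≤S j≤T) l≤U) , app d e f

  ⇓case-leaf : ∀ {t a b w S T} →
    ρ ⊢ t ⇓ leaf within S → ρ ⊢ a ⇓ w within T →
    ρ ⊢ case t a b ⇓ w within suc (S + T)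
  ⇓case-leaf (_ , i≤S , d) (_ , j≤T , e) =
    _ , s≤s (+-mono-≤ i≤S j≤T) , case-leaf d e

  ⇓case-node : ∀ {t a b u v w S T} →
    ρ ⊢ t ⇓ node u v within S → u ∷ v ∷ ρ ⊢ b ⇓ w within T →
    ρ ⊢ case t a b ⇓ w within suc (S + T)
  ⇓case-node (_ , i≤S , d) (_ , j≤T , e) =
    _ , s≤s (+-mono-≤ i≤S j≤T) , case-node d e

  -- `encodeBool true` is a node with two leaves, so the positive branch runs with two more leaves
  -- in its environment. Both branches share the bound `T`; the cheaper one is relaxed to it.
  ⇓if : ∀ {ℓ} {A : Set ℓ} (f : A → Value) b {t u v x y S T} →
        ρ ⊢ t ⇓ boolean b within S →
        leaf ∷ leaf ∷ ρ ⊢ u ⇓ f x within T → ρ ⊢ v ⇓ f y within T →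
        ρ ⊢ case t v u ⇓ f (if b then x else y) within suc (S + T)
  ⇓if f true  d e _ = ⇓case-node d e
  ⇓if f false d _ e = ⇓case-leaf d e

  -- The outcome of the test is handed to the branches as an equation. The time analysis of `search`
  -- needs it to see that rows disappear.
  ⇓null : ∀ {ℓ} {A : Set ℓ} (f : A → Value) (st : List (Vec Bool m)) {t u v x y S T} →
          ρ ⊢ t ⇓ rows st within S →
          (null st ≡ true → ρ ⊢ u ⇓ f x within T) →
          (null st ≡ false → ∀ {h t} → h ∷ t ∷ ρ ⊢ v ⇓ f y within T) →
          ρ ⊢ case t u v ⇓ f (if null st then x else y) within suc (S + T)
  ⇓null f []      d e _ = ⇓case-leaf d (e refl)
  ⇓null f (_ ∷ _) d _ e = ⇓case-node d (e refl)

-- Boolean constants and decision trees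

bool : Bool → Term n
bool false = leaf
bool true  = node leaf leaf

bool-run : ∀ {ρ : Env n} b → ρ ⊢ bool b ⇓ boolean b within 3
bool-run false = relax (s≤s z≤n) ⇓leaf
bool-run true  = ⇓node ⇓leaf ⇓leaf

-- The truth table of `p` is compiled into a decision tree, so `p` itself costs nothing at run time.
-- A positive answer binds two subtrees, hence the shift of the remaining indices by 2.
decide : Vec (Fin n) m → (Vec Bool m → Bool) → Term n
decide []       p = bool (p [])
decide (i ∷ is) p = case (var i)
  (decide is (p ∘ (false ∷_)))
  (decide (Vec.map (2 ↑ʳ_) is) (p ∘ (true ∷_)))

decide-run : ∀ {ρ : Env n} (is : Vec (Fin n) m) p bs →
             Vec.map (lookup ρ) is ≡ Vec.map boolean bs →
             ρ ⊢ decide is p ⇓ boolean (p bs) within 2 * m + 3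
decide-run [] p [] eq = bool-run (p [])
decide-run (i ∷ is) p (b ∷ bs) eq with ∷-injective eq
decide-run {m = suc m} (i ∷ is) p (false ∷ bs) _ | eqᵢ , eqs =
  relax (≤-reflexive (cong (_+ 3) (sym (*-suc 2 m))))
    (⇓case-leaf (⇓var-≡ eqᵢ) (decide-run is (p ∘ (false ∷_)) bs eqs))
decide-run {m = suc m} (i ∷ is) p (true ∷ bs) _ | eqᵢ , eqs =
  relax (≤-reflexive (cong (_+ 3) (sym (*-suc 2 m))))
    (⇓case-node (⇓var-≡ eqᵢ)
      (decide-run (Vec.map (2 ↑ʳ_) is) (p ∘ (true ∷_)) bs
        (trans (sym (map-∘ _ _ is)) eqs)))

-- Filtering rows and deleting the first user column

-- A row describes a step: its membership in S₁ and in S₂, followed by the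
-- users authorized for it.
Rows : ℕ → Set
Rows n = List (Vec Bool (2 + n))

Test : Set
Test = Vec Bool 3 → Bool

keep : Test → Rows (suc n) → Rows n
keep p []                     = []
keep p ((a ∷ b ∷ x ∷ r) ∷ st) =
  if p (a ∷ b ∷ x ∷ []) then (a ∷ b ∷ r) ∷ keep p st else keep p st

-- After the four cases, indices 4, 2 and 0 hold the two memberships and the entry of the first
-- user, 1 the remaining users, 7 the remaining rows and 9 the function itself. All of them move up
-- by 2 when the test succeeds.
keepBody : Test → Term (2 + n)
keepBody p =
  case (var (# 0)) leaf
    (case (var (# 0)) leaf
      (case (var (# 1)) leaf
        (case (var (# 1)) leaf
          (case (decide (# 4 ∷ # 2 ∷ # 0 ∷ []) p)
            (app (var (# 9)) (var (# 7)))
            (node (node (var (# 6)) (node (var (# 4)) (var (# 3))))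
              (app (var (# 11)) (var (# 9))))))))

keep-run : ∀ {ρ : Env m} p (st : Rows (suc n)) →
           rows st ∷ closure (keepBody p) ρ ∷ ρ ⊢ keepBody p
             ⇓ rows (keep p st) within 28 * suc (length st)
keep-run p [] = relax (m≤m+n 3 25) (⇓case-leaf ⇓var ⇓leaf)
keep-run p ((a ∷ b ∷ x ∷ r) ∷ st) =
  -- A row costs at most 27: 8 for the four cases, 10 for the test, 9 for rebuilding the row and
  -- calling the function again.
  relax (≤-trans (+-monoˡ-≤ _ (m≤m+n 27 1))
                 (≤-reflexive (sym (*-suc 28 (suc (length st)))))) $
  ⇓case-node ⇓var $ ⇓case-node ⇓var $ ⇓case-node ⇓var $ ⇓case-node ⇓var $
  ⇓if rows (p (a ∷ b ∷ x ∷ []))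
    (decide-run (# 4 ∷ # 2 ∷ # 0 ∷ []) p (a ∷ b ∷ x ∷ []) refl)
    (⇓node (⇓node ⇓var (⇓node ⇓var ⇓var)) (⇓app ⇓var ⇓var (keep-run p st)))
    (relax (m≤n+m _ 6) (⇓app ⇓var ⇓var (keep-run p st)))

keepAt : Test → Fin n → Term n
keepAt p i = app (fix (keepBody p)) (var i)

keepAt-run : ∀ {K} {ρ : Env m} {i} p (st : Rows (suc n)) → length st ≤ K →
             lookup ρ i ≡ rows st →
             ρ ⊢ keepAt p i ⇓ rows (keep p st) within 31 * suc K
keepAt-run {K = K} p st st≤K eq =
  relax (≤-trans (+-mono-≤ (m≤m+n 3 (3 * K)) (*-monoʳ-≤ 28 (s≤s st≤K)))
                 (≤-reflexive (lemma K)))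
    (⇓app ⇓fix (⇓var-≡ eq) (keep-run p st))
  where
  lemma : ∀ k → 3 + 3 * k + 28 * suc k ≡ 31 * suc k
  lemma = solve-∀

-- In t, index 8 is the argument and index 9 the function itself.
sweep : Term (10 + n) → Term (2 + n)
sweep t =
  case (var (# 0)) (bool true)
    (case (var (# 0)) leaf
      (case (var (# 1)) leaf
        (case (var (# 1)) leaf t)))

module _ {f : Value} {ρ : Env m} where

  sweep-empty : ∀ {t} → leaf ∷ f ∷ ρ ⊢ sweep t ⇓ boolean true within 5
  sweep-empty = ⇓case-leaf ⇓var (bool-run true)

  -- A row of length 2 has no user column left: a step remains, but nobody to perform it. The fourth
  -- case then meets a leaf.
  sweep-exhausted : ∀ {t} (r : Vec Bool 2) st →
                    rows (r ∷ st) ∷ f ∷ ρ ⊢ sweep t ⇓ boolean false within 9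
  sweep-exhausted (_ ∷ _ ∷ []) st =
    ⇓case-node ⇓var $ ⇓case-node ⇓var $ ⇓case-node ⇓var $
    ⇓case-leaf ⇓var ⇓leaf

-- Equality constraints: search for a labelling of the users

-- A user labelled false may only be assigned to steps outside S₂, and one
-- labelled true only to steps outside S₁.
covers : Bool → Test
covers l (a ∷ b ∷ x ∷ []) = x ∧ not (if l then a else b)

misses : Bool → Test
misses l = not ∘ covers l

-- The two emptiness tests guard the double recursion. Branching at every user would take time
-- exponential in the number of users.
search : ∀ n → Rows n → Bool
search _       []       = true
search zero    (_ ∷ _)  = false
search (suc n) st@(_ ∷ _) =
  if null (keep (covers false) st) then search n (keep (misses true) st)
  else if null (keep (covers true) st) then search n (keep (misses false) st)
  else if search n (keep (misses false) st) then true
  else search n (keep (misses true) st)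

searchBody : Term (2 + n)
searchBody = sweep
  (case (keepAt (covers false) (# 8))
    (app (var (# 9)) (keepAt (misses true) (# 8)))
    (case (keepAt (covers true) (# 10))
      (app (var (# 11)) (keepAt (misses false) (# 10)))
      (case (app (var (# 13)) (keepAt (misses false) (# 12)))
        (app (var (# 13)) (keepAt (misses true) (# 12)))
        (bool true))))

keep-≤ : ∀ p (st : Rows (suc n)) → length (keep p st) ≤ length st
keep-≤ p []                     = z≤n
keep-≤ p ((a ∷ b ∷ x ∷ r) ∷ st) with p (a ∷ b ∷ x ∷ [])
... | true  = s≤s (keep-≤ p st)
... | false = m≤n⇒m≤1+n (keep-≤ p st)

-- Some row passes `p`, and that row is discarded by the negated test.
keep-< : ∀ p (st : Rows (suc n)) → null (keep p st) ≡ false →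
         length (keep (not ∘ p) st) < length st
keep-< p ((a ∷ b ∷ x ∷ r) ∷ st) eq with p (a ∷ b ∷ x ∷ [])
... | true  = s≤s (keep-≤ (not ∘ p) st)
... | false = s≤s (keep-< p st eq)

-- There are at most 2 ^ l branches when l rows are left, and a column costs
-- at most 140 per row, of which there are at most K.
budget : ℕ → ℕ → ℕ → ℕ
budget K n l = 2 ^ l * (suc n * (140 * suc K))

budget-mono : ∀ K n {k l} → k ≤ l → budget K n k ≤ budget K n l
budget-mono K n k≤l = *-monoˡ-≤ (suc n * (140 * suc K)) (^-monoʳ-≤ 2 k≤l)

-- Each branch has lost at least one row, so each of the two powers of 2 is at most half of `2 ^ l`.
budget-branch : ∀ K n {j k l} → j < l → k < l →
                budget K n j + budget K n k ≤ budget K n l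
budget-branch K n {j} {k} {suc l} (s≤s j≤l) (s≤s k≤l) = begin
  budget K n j + budget K n k  ≤⟨ +-mono-≤ (budget-mono K n j≤l) (budget-mono K n k≤l) ⟩
  budget K n l + budget K n l  ≡⟨ lemma (2 ^ l) (suc n * (140 * suc K)) ⟩
  budget K n (suc l)           ∎
  where
  open ≤-Reasoning
  lemma : ∀ x y → x * y + x * y ≡ 2 * x * y
  lemma = solve-∀

-- One more column adds `140 * suc K` a total of `2 ^ l` times, which is at least once.
budget-suc : ∀ K n l → 140 * suc K + budget K n l ≤ budget K (suc n) l
budget-suc K n l = begin
  P + 2 ^ l * X          ≤⟨ +-monoˡ-≤ _ (m≤n*m P (2 ^ l)) ⟩
  2 ^ l * P + 2 ^ l * X  ≡⟨ *-distribˡ-+ (2 ^ l) P X ⟨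
  2 ^ l * (P + X)        ∎
  where
  open ≤-Reasoning
  P = 140 * suc K
  X = suc n * P
  instance _ = m^n≢0 2 l

-- The successors in `budget` leave room for the base cases, where users or rows have run out.
140≤budget : ∀ K n l → 140 ≤ budget K n l
140≤budget K n l = begin
  140                           ≤⟨ m≤m*n 140 (suc K) ⟩
  140 * suc K                   ≤⟨ m≤n*m (140 * suc K) (suc n) ⟩
  suc n * (140 * suc K)         ≤⟨ m≤n*m (suc n * (140 * suc K)) (2 ^ l) ⟩
  budget K n l                  ∎
  where
  open ≤-Reasoning
  instance _ = m^n≢0 2 l

-- Naming the difference `c` reduces a polynomial inequality to an identity for the ring solver.
slack : ∀ {a b} c → a + c ≡ b → a ≤ b
slack c refl = m≤m+n _ c

search-run : ∀ {K} {ρ : Env m} n (st : Rows n) → length st ≤ K →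
             rows st ∷ closure searchBody ρ ∷ ρ ⊢ searchBody
               ⇓ boolean (search n st) within budget K n (length st)
search-run {K = K} n [] _ =
  relax (≤-trans (m≤m+n 5 135) (140≤budget K n 0)) sweep-empty
search-run {K = K} zero (r ∷ st) _ =
  relax (≤-trans (m≤m+n 9 131) (140≤budget K zero (suc (length st))))
    (sweep-exhausted r st)
search-run {K = K} (suc n) st@((_ ∷ _ ∷ _ ∷ _) ∷ _) st≤K =
  -- The longest path makes four scans at `31 * suc K` each and spends 15 besides;
  -- `124 * suc K + 15` is below `140 * suc K`.
  relax (≤-trans (slack _ (total K B)) (budget-suc K n (length st))) $
  ⇓case-node ⇓var $ ⇓case-node ⇓var $ ⇓case-node ⇓var $ ⇓case-node ⇓var $
  ⇓null boolean (keep (covers false) st) (scan (covers false) refl)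
    (λ _ → relax (slack _ (first K B)) $ ⇓app ⇓var (scan (misses true) refl) $
      relax (budget-mono K n (keep-≤ (misses true) st)) (recurse (misses true)))
    (λ nonempty₁ →
      ⇓null boolean (keep (covers true) st) (scan (covers true) refl)
        (λ _ → relax (slack _ (second K B)) $ ⇓app ⇓var (scan (misses false) refl) $
          relax (budget-mono K n (keep-≤ (misses false) st)) (recurse (misses false)))
        (λ nonempty₂ →
          -- Each label covers a row here, so both recursive calls receive strictly fewer rows.
          relax (≤-trans (≤-reflexive (third K _ _))
                         (+-monoʳ-≤ (5 + 62 * suc K)
                           (budget-branch K n (keep-< (covers false) st nonempty₁)
                                              (keep-< (covers true) st nonempty₂)))) $
          ⇓if boolean (search n (keep (misses false) st))
            (⇓app ⇓var (scan (misses false) refl) (recurse (misses false)))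
            (relax (m≤m+n 3 _) (bool-run true))
            (⇓app ⇓var (scan (misses true) refl) (recurse (misses true)))))
  where
  B = budget K n (length st)

  scan : ∀ {k} {ρ : Env k} {i} p → lookup ρ i ≡ rows st →
         ρ ⊢ keepAt p i ⇓ rows (keep p st) within 31 * suc K
  scan p = keepAt-run p st st≤K

  recurse : ∀ {k} {ρ : Env k} p →
            rows (keep p st) ∷ closure searchBody ρ ∷ ρ ⊢ searchBody
              ⇓ boolean (search n (keep p st))
              within budget K n (length (keep p st))
  recurse p = search-run n (keep p st) (≤-trans (keep-≤ p st) st≤K)

  total : ∀ k b → 9 + (31 * suc k + (1 + (31 * suc k + (5 + 62 * suc k + b))))
                    + (1 + 16 * k) ≡ 140 * suc k + b
  total = solve-∀

  first : ∀ k b → 2 + (31 * suc k + b) + (4 + 62 * suc k) ≡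
                  1 + (31 * suc k + (5 + 62 * suc k + b))
  first = solve-∀

  second : ∀ k b → 2 + (31 * suc k + b) + (3 + 31 * suc k) ≡
                   5 + 62 * suc k + b
  second = solve-∀

  third : ∀ k x y → 1 + (2 + (31 * suc k + x) + (2 + (31 * suc k + y))) ≡
                    5 + 62 * suc k + (x + y)
  third = solve-∀

-- Inequality constraints: one user for all steps concerned

in₁ in₂ uncovered any-row : Test
in₁ (a ∷ _ ∷ _ ∷ [])       = a
in₂ (_ ∷ b ∷ _ ∷ [])       = b
uncovered (a ∷ b ∷ x ∷ []) = (a ∨ b) ∧ not x
any-row _                  = true

-- A single user has to serve every step of the union, so when the first user does not qualify all
-- rows are passed on. The test `any-row` accepts everything and merely drops the column.
unify : ∀ n → Rows n → Bool
unify _       []       = true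
-- Either there were no users from the start, and then no plan exists, or both sides were found
-- inhabited and every user was rejected.
unify zero    (_ ∷ _)  = false
unify (suc n) st@(_ ∷ _) =
  if null (keep in₁ st) then true
  else if null (keep in₂ st) then true
  else if null (keep uncovered st) then true
  else unify n (keep any-row st)

unifyBody : Term (2 + n)
unifyBody = sweep
  (case (keepAt in₁ (# 8)) (bool true)
    (case (keepAt in₂ (# 10)) (bool true)
      (case (keepAt uncovered (# 12)) (bool true)
        (app (var (# 15)) (keepAt any-row (# 14))))))

unify-run : ∀ {K} {ρ : Env m} n (st : Rows n) → length st ≤ K →
            rows st ∷ closure unifyBody ρ ∷ ρ ⊢ unifyBody
              ⇓ boolean (unify n st) within budget K n (length st)
unify-run {K = K} n [] _ =
  relax (≤-trans (m≤m+n 5 135) (140≤budget K n 0)) sweep-empty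
unify-run {K = K} zero (r ∷ st) _ =
  relax (≤-trans (m≤m+n 9 131) (140≤budget K zero (suc (length st))))
    (sweep-exhausted r st)
unify-run {K = K} (suc n) st@((_ ∷ _ ∷ _ ∷ _) ∷ _) st≤K =
  -- Again at most four scans, with 13 besides.
  relax (≤-trans (slack _ (total K B)) (budget-suc K n (length st))) $
  ⇓case-node ⇓var $ ⇓case-node ⇓var $ ⇓case-node ⇓var $ ⇓case-node ⇓var $
  ⇓null boolean (keep in₁ st) (scan in₁ refl)
    (λ _ → relax (constant _) (bool-run true)) λ _ →
  ⇓null boolean (keep in₂ st) (scan in₂ refl)
    (λ _ → relax (constant _) (bool-run true)) λ _ →
  ⇓null boolean (keep uncovered st) (scan uncovered refl)
    (λ _ → relax (s≤s (s≤s (s≤s z≤n))) (bool-run true)) λ _ →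
  ⇓app ⇓var (scan any-row refl)
    (relax (budget-mono K n (keep-≤ any-row st))
      (unify-run n (keep any-row st) (≤-trans (keep-≤ any-row st) st≤K)))
  where
  B = budget K n (length st)

  scan : ∀ {k} {ρ : Env k} {i} p → lookup ρ i ≡ rows st →
         ρ ⊢ keepAt p i ⇓ rows (keep p st) within 31 * suc K
  scan p = keepAt-run p st st≤K

  constant : ∀ b → 3 ≤ 1 + (31 * suc K + b)
  constant b = s≤s (≤-trans (s≤s (s≤s z≤n)) (≤-trans (m≤m*n 31 (suc K)) (m≤m+n _ b)))

  total : ∀ k b → 9 + (31 * suc k + (1 + (31 * suc k + (1 + (31 * suc k + (2 + (31 * suc k + b)))))))
                    + (3 + 16 * k) ≡ 140 * suc k + b
  total = solve-∀

-- The algorithm applied to a whole specification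

prepend : Vec Bool k → FinRel k n → FinRel k (suc n)
prepend = Vec.zipWith _∷_

-- The function is curried: index 0 is the relation, 2 the column to be put in front and 3 the outer
-- function, which the recursion calls on both tails.
prependBody : Term (4 + n)
prependBody =
  case (var (# 2)) leaf
    (case (var (# 2)) leaf
      (node (node (var (# 2)) (var (# 0)))
        (app (app (var (# 7)) (var (# 3))) (var (# 1)))))

prependTerm : Term n
prependTerm = fix (fix prependBody)

prepend-run : ∀ {f} {ρ : Env m} (bs : Vec Bool k) (R : FinRel k n) →
              value (encodeRel R) ∷ f ∷ value (encodeSubset bs) ∷
                closure (fix prependBody) ρ ∷ ρ ⊢ prependBody
                ⇓ value (encodeRel (prepend bs R)) within 14 * suc k
prepend-run [] [] = relax (m≤m+n 3 11) (⇓case-leaf ⇓var ⇓leaf)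
prepend-run {k = suc k} (b ∷ bs) (r ∷ R) =
  relax (≤-reflexive (sym (*-suc 14 (suc k)))) $
  ⇓case-node ⇓var $ ⇓case-node ⇓var $
  ⇓node (⇓node ⇓var ⇓var)
    (⇓app (⇓app ⇓var ⇓var ⇓fix) ⇓var (prepend-run bs R))

table : Subset k → Subset k → FinRel k n → Rows n
table S₁ S₂ A = Vec.toList (prepend S₁ (prepend S₂ A))

violable : FinRel k n → (c : Constraint k n) → EqualityOrInequality c → Bool
violable A ⟨ _ , S₁ , S₂ ⟩ (inj₁ _) = search _ (table S₁ S₂ A)
violable A ⟨ _ , S₁ , S₂ ⟩ (inj₂ _) = unify _ (table S₁ S₂ A)

anyViolable : FinRel k n → {cs : List (Constraint k n)} →
              All EqualityOrInequality cs → Bool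
anyViolable A []             = false
anyViolable A (_∷_ {x = c} form forms) =
  if violable A c form then true else anyViolable A forms

module _ (S₁ S₂ : Subset k) (A : FinRel k n) where

  private
    fits = ≤-reflexive (length-toList (prepend S₁ (prepend S₂ A)))

  within-budget : ∀ {ρ : Env m} {t v} →
    (length (table S₁ S₂ A) ≤ k →
     ρ ⊢ t ⇓ v within budget k n (length (table S₁ S₂ A))) →
    ρ ⊢ t ⇓ v within budget k n k
  within-budget run = relax (budget-mono k n fits) (run fits)

  table-run : ∀ {ρ : Env m} {i j l} →
    lookup ρ i ≡ value (encodeSubset S₁) →
    lookup ρ j ≡ value (encodeSubset S₂) →
    lookup ρ l ≡ value (encodeRel A) →
    ρ ⊢ app (app prependTerm (var i)) (app (app prependTerm (var j)) (var l))
      ⇓ rows (table S₁ S₂ A) within 11 + 28 * suc k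
  table-run e f g = relax (≤-reflexive (lemma k)) $
    ⇓app (⇓app ⇓fix (⇓var-≡ e) ⇓fix)
      (⇓app (⇓app ⇓fix (⇓var-≡ f) ⇓fix) (⇓var-≡ g) (prepend-run S₂ A))
      (prepend-run S₁ (prepend S₂ A))
    where
    lemma : ∀ k → 5 + (6 + 14 * suc k) + 14 * suc k ≡ 11 + 28 * suc k
    lemma = solve-∀

check : Fin n → Fin n → Term n
check i j =
  case (var i) leaf
    (case (var (# 1)) leaf
      (app (case (var (# 2)) (fix unifyBody) (fix searchBody))
           (app (app prependTerm (var (# 0)))
             (app (app prependTerm (var (# 1))) (var (4 ↑ʳ j))))))

check-run : ∀ {ρ : Env m} {i j} (A : FinRel k n) c form →
            lookup ρ i ≡ value (encodeConstraint c form) →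
            lookup ρ j ≡ value (encodeRel A) →
            ρ ⊢ check i j ⇓ boolean (violable A c form)
              within 19 + 28 * suc k + budget k n k
check-run {k = k} {n = n} A ⟨ _ , S₁ , S₂ ⟩ (inj₁ _) eqᵢ eqⱼ =
  ⇓case-node (⇓var-≡ eqᵢ) $ ⇓case-node ⇓var $
  ⇓app (⇓case-node ⇓var ⇓fix) (table-run S₁ S₂ A refl refl eqⱼ)
       (within-budget S₁ S₂ A (search-run n (table S₁ S₂ A)))
check-run {k = k} {n = n} A ⟨ _ , S₁ , S₂ ⟩ (inj₂ _) eqᵢ eqⱼ =
  ⇓case-node (⇓var-≡ eqᵢ) $ ⇓case-node ⇓var $
  ⇓app (⇓case-leaf ⇓var ⇓fix) (table-run S₁ S₂ A refl refl eqⱼ)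
       (within-budget S₁ S₂ A (unify-run n (table S₁ S₂ A)))

constraintsBody : Term (3 + n)
constraintsBody =
  case (var (# 0)) (bool false)
    (case (check (# 0) (# 4))
      (app (var (# 3)) (var (# 1)))
      (bool true))

-- One `budget` pays for `search` or `unify`, the other for decoding the constraint, building its
-- table and passing to the next one.
perConstraint : ℕ → ℕ → ℕ
perConstraint k n = 2 * budget k n k

constraints-run : ∀ {ρ : Env m} (A : FinRel k n) {cs : List (Constraint k n)}
                  (forms : All EqualityOrInequality cs) →
                  value (encodeConstraints forms) ∷
                    closure constraintsBody (value (encodeRel A) ∷ ρ) ∷
                    value (encodeRel A) ∷ ρ ⊢ constraintsBody
                    ⇓ boolean (anyViolable A forms)
                    within suc (length cs) * perConstraint k n
constraints-run {k = k} {n = n} A [] =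
  relax (≤-trans (≤-trans (m≤m+n 5 135) (140≤budget k n k))
                 (≤-trans (m≤m+n _ _) (m≤m+n _ _)))
    (⇓case-leaf ⇓var (bool-run false))
constraints-run {k = k} {n = n} A (_∷_ {x = c} form forms) =
  relax (≤-trans (≤-reflexive (shuffle (28 * suc k) (budget k n k) _))
          (+-monoˡ-≤ _ (≤-trans (+-monoˡ-≤ _ overhead)
            (≤-reflexive (sym (cong (budget k n k +_) (+-identityʳ _))))))) $
  ⇓case-node ⇓var $
  ⇓if boolean (violable A c form)
    (check-run A c form refl refl)
    (relax (m≤m+n 3 _) (bool-run true))
    (⇓app ⇓var ⇓var (constraints-run A forms))
  where
  shuffle : ∀ x b r → 3 + (19 + x + b + (3 + r)) ≡ 25 + x + b + r
  shuffle = solve-∀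

  overhead : 25 + 28 * suc k ≤ budget k n k
  overhead = begin
    25 + 28 * suc k        ≤⟨ slack _ (lemma k) ⟩
    140 * suc k            ≤⟨ m≤n*m (140 * suc k) (suc n) ⟩
    suc n * (140 * suc k)  ≤⟨ m≤n*m (suc n * (140 * suc k)) (2 ^ k) ⟩
    budget k n k           ∎
    where
    open ≤-Reasoning
    instance _ = m^n≢0 2 k
    lemma : ∀ k → 25 + 28 * suc k + (87 + 112 * k) ≡ 140 * suc k
    lemma = solve-∀

-- After the three cases, index 0 is the policy and 1 the list of constraints. The closure captures
-- the policy, so the recursion passes on the list alone.
main : Algorithm
main =
  case (var (# 0)) leaf
    (case (var (# 1)) leaf
      (case (var (# 1)) leaf
        (app (fix constraintsBody) (var (# 1)))))

module _ (W : EqualitySpecification) where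
  open EqualitySpecification W

  answer : Bool
  answer = anyViolable A restricted

  main-run : value (encodeSpecification W) ∷ [] ⊢ main ⇓ boolean answer
               within 9 + suc (length constraints) * perConstraint steps users
  main-run = ⇓case-node ⇓var $ ⇓case-node ⇓var $ ⇓case-node ⇓var $
    ⇓app ⇓fix ⇓var (constraints-run A restricted)

-- Running time in terms of the size of the input

size-encodeFinite : ∀ n → n < size (encodeFinite n)
size-encodeFinite zero    = s≤s z≤n
size-encodeFinite (suc n) = s≤s (m≤n⇒m≤1+n (size-encodeFinite n))

size-encodeConstraints : ∀ {cs : List (Constraint k n)} (forms : All EqualityOrInequality cs) →
                         length cs < size (encodeConstraints forms)
size-encodeConstraints []             = s≤s z≤n
size-encodeConstraints (form ∷ forms) =
  s≤s (≤-trans (size-encodeConstraints forms) (m≤n+m _ _))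

sizeˡ : ∀ l r → size l < size (node l r)
sizeˡ l r = s≤s (m≤m+n (size l) (size r))

sizeʳ : ∀ l r → size r < size (node l r)
sizeʳ l r = s≤s (m≤n+m (size r) (size l))

module _ (W : EqualitySpecification) where
  open EqualitySpecification W
  open ≤-Reasoning

  private
    N = size (encodeSpecification W)

    cs t₀ t₁ t₂ : Tree
    cs = encodeConstraints restricted
    t₀ = node (encodeFinite steps) (encodeRel E)
    t₁ = node (encodeRel A) cs
    t₂ = node (encodeFinite users) t₁

  -- The unary notation for finite sets makes this linear bound possible.
  users<size : users < N
  users<size = begin-strict
    users                      <⟨ size-encodeFinite users ⟩
    size (encodeFinite users)  <⟨ sizeˡ (encodeFinite users) t₁ ⟩
    size t₂                    <⟨ sizeʳ t₀ t₂ ⟩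
    N                          ∎

  constraints<size : suc (length constraints) < N
  constraints<size = begin-strict
    suc (length constraints)  ≤⟨ size-encodeConstraints restricted ⟩
    size cs                   <⟨ sizeʳ (encodeRel A) cs ⟩
    size t₁                   <⟨ sizeʳ (encodeFinite users) t₁ ⟩
    size t₂                   <⟨ sizeʳ t₀ t₂ ⟩
    N                         ∎

  -- Apart from `2 ^ steps * suc steps`, the time is a product of one factor for the users and one
  -- for the constraints. Each is at most `N`, whence the exponent 2; the constant is `2 * 140`.
  time-bound : 9 + suc (length constraints) * perConstraint steps users ≤
               280 * (2 ^ steps * suc steps * N ^ 2)
  time-bound = begin
    -- The 9 steps of decoding are charged as one more constraint.
    9 + suc l * P      ≤⟨ +-monoˡ-≤ _ (≤-trans (m≤m+n 9 131)
                            (≤-trans (140≤budget steps users steps) (m≤m+n _ _))) ⟩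
    suc (suc l) * P    ≡⟨ lemma (suc (suc l)) (2 ^ steps) (suc steps) (suc users) ⟩
    280 * (2 ^ steps * suc steps * (suc users * (suc (suc l) * 1)))
                       ≤⟨ *-monoʳ-≤ 280 (*-monoʳ-≤ (2 ^ steps * suc steps)
                            (*-mono-≤ users<size (*-monoˡ-≤ 1 constraints<size))) ⟩
    280 * (2 ^ steps * suc steps * N ^ 2) ∎
    where
    l = length constraints
    P = perConstraint steps users
    lemma : ∀ m x k n → m * (2 * (x * (n * (140 * k)))) ≡ 280 * (x * k * (n * (m * 1)))
    lemma = solve-∀

-- Correctness

if-true⁺ : ∀ b {x y} → (b ≡ true → x ≡ true) → (b ≡ false → y ≡ true) →
           (if b then x else y) ≡ true
if-true⁺ true  x _ = x refl
if-true⁺ false _ y = y refl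

if-true⁻ : ∀ b {x y} → (if b then x else y) ≡ true →
           (b ≡ true × x ≡ true) ⊎ (b ≡ false × y ≡ true)
if-true⁻ true  eq = inj₁ (refl , eq)
if-true⁻ false eq = inj₂ (refl , eq)

-- Properties of rows before and after the deletion of a column

module _ (p : Test) {P : Vec Bool (2 + n) → Set} {Q : Vec Bool (3 + n) → Set} where

  keep⁺ : (∀ {a b x r} → p (a ∷ b ∷ x ∷ []) ≡ true → Q (a ∷ b ∷ x ∷ r) → P (a ∷ b ∷ r)) →
          ∀ {st} → All Q st → All P (keep p st)
  keep⁺ f [] = []
  keep⁺ f {(a ∷ b ∷ x ∷ r) ∷ st} (q ∷ qs) with p (a ∷ b ∷ x ∷ []) in eq
  ... | true  = f eq q ∷ keep⁺ f qs
  ... | false = keep⁺ f qs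

  -- A discarded row leaves nothing in `keep p st`. For it the implication given to `f` is vacuous,
  -- and `f` has to draw `Q` from the failure of the test.
  keep⁻ : (∀ {a b x r} → (p (a ∷ b ∷ x ∷ []) ≡ true → P (a ∷ b ∷ r)) → Q (a ∷ b ∷ x ∷ r)) →
          ∀ st → All P (keep p st) → All Q st
  keep⁻ f [] _ = []
  keep⁻ f ((a ∷ b ∷ x ∷ r) ∷ st) ps with p (a ∷ b ∷ x ∷ []) in eq
  keep⁻ f ((a ∷ b ∷ x ∷ r) ∷ st) (p′ ∷ ps) | true  = f (const p′) ∷ keep⁻ f st ps
  keep⁻ f ((a ∷ b ∷ x ∷ r) ∷ st) ps        | false =
    f (λ t → contradiction eq (not-¬ t)) ∷ keep⁻ f st ps

Fails : Test → Vec Bool (3 + n) → Set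
Fails p (a ∷ b ∷ x ∷ _) = p (a ∷ b ∷ x ∷ []) ≡ false

-- A list is empty when all its members satisfy a contradiction, so emptiness is the instance
-- `P = const ⊥` of `keep⁻`.
null⁻ : ∀ p (st : Rows (suc n)) → null (keep p st) ≡ true → All (Fails p) st
null⁻ p st eq = keep⁻ p {P = const ⊥} (λ f → ¬-not f) st (none (keep p st) eq)
  where
  none : ∀ (st : Rows n) → null st ≡ true → All (const ⊥) st
  none [] _ = []

null⁺ : ∀ p {st : Rows (suc n)} → All (Fails p) st → null (keep p st) ≡ true
null⁺ p fs = none (keep⁺ p {P = const ⊥} (λ t f → contradiction f (not-¬ t)) fs)
  where
  none : ∀ {st : Rows n} → All (const ⊥) st → null st ≡ true
  none [] = refl

-- Equality constraints: correctness of the search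

Covered : Vec Bool n → Vec Bool (2 + n) → Set
Covered ℓ (a ∷ b ∷ r) = ∃[ u ] covers (lookup ℓ u) (a ∷ b ∷ lookup r u ∷ []) ≡ true

-- Once the labels are fixed, the steps choose their users independently of each other; the labels
-- alone keep the users of S₁ and S₂ apart.
Colourable : ∀ n → Rows n → Set
Colourable n st = ∃[ ℓ ] All (Covered ℓ) st

-- The first user takes every row that it covers under `l`; the others are covered by later users.
colour⁺ : ∀ l {st : Rows (suc n)} → Colourable n (keep (misses l) st) → Colourable (suc n) st
colour⁺ l {st} (ℓ , cov) = l ∷ ℓ , keep⁻ (misses l) extend st cov
  where
  extend : ∀ {a b x r} → (misses l (a ∷ b ∷ x ∷ []) ≡ true → Covered ℓ (a ∷ b ∷ r)) →
           Covered (l ∷ ℓ) (a ∷ b ∷ x ∷ r)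
  extend {a} {b} {x} f with covers l (a ∷ b ∷ x ∷ []) in eq
  ... | true  = zero , eq
  ... | false with u , c ← f refl = suc u , c

colour⁻ : ∀ {st : Rows (suc n)} → Colourable (suc n) st →
          ∃[ l ] Colourable n (keep (misses l) st)
colour⁻ (l ∷ ℓ , cov) = l , ℓ , keep⁺ (misses l) restrict cov
  where
  restrict : ∀ {a b x r} → misses l (a ∷ b ∷ x ∷ []) ≡ true →
             Covered (l ∷ ℓ) (a ∷ b ∷ x ∷ r) → Covered ℓ (a ∷ b ∷ r)
  restrict t (zero  , c) = contradiction (cong not c) (not-¬ t)
  restrict t (suc u , c) = u , c

-- If label l covers no row in the first column, choosing it drops no row, so
-- no other choice keeps more.
colour-skip : ∀ l p (st : Rows (suc n)) → null (keep (covers l) st) ≡ true →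
              Colourable n (keep (misses l) st) → Colourable n (keep p st)
colour-skip l p st eq (ℓ , cov) =
  ℓ , keep⁺ p {Q = λ { (a ∷ b ∷ _ ∷ r) → Covered ℓ (a ∷ b ∷ r) }} (λ _ c → c)
        (All.zipWith
          {Q = λ { (a ∷ b ∷ x ∷ r) → misses l (a ∷ b ∷ x ∷ []) ≡ true →
                                     Covered ℓ (a ∷ b ∷ r) }}
          (λ { {_ ∷ _ ∷ _ ∷ _} (f , g) → g (cong not f) })
          (null⁻ (covers l) st eq , keep⁻ (misses l) (λ f → f) st cov))

search-sound : ∀ n (st : Rows n) → search n st ≡ true → Colourable n st
search-sound n [] _ = Vec.replicate n false , []
search-sound (suc n) st@(_ ∷ _) eq
  with if-true⁻ (null (keep (covers false) st)) eq
... | inj₁ (_ , s) = colour⁺ true (search-sound n _ s)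
... | inj₂ (_ , eq)
  with if-true⁻ (null (keep (covers true) st)) eq
... | inj₁ (_ , s) = colour⁺ false (search-sound n _ s)
... | inj₂ (_ , eq)
  with if-true⁻ (search n (keep (misses false) st)) eq
... | inj₁ (s , _) = colour⁺ false (search-sound n _ s)
... | inj₂ (_ , s) = colour⁺ true (search-sound n _ s)

search-complete : ∀ n (st : Rows n) → Colourable n st → search n st ≡ true
search-complete n [] _ = refl
search-complete zero ((_ ∷ _ ∷ _) ∷ _) (_ , (() , _) ∷ _)
search-complete (suc n) st@(_ ∷ _) col with colour⁻ col
... | false , c =
  if-true⁺ (null (keep (covers false) st))
    -- The given labelling starts with `false`, which covers no row here, so `true` does as well.
    (λ none → search-complete n _ (colour-skip false (misses true) st none c)) λ _ →
  if-true⁺ (null (keep (covers true) st)) (λ _ → search-complete n _ c) λ _ →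
  if-true⁺ (search n (keep (misses false) st)) (λ _ → refl)
    (λ eq → contradiction eq (not-¬ (search-complete n _ c)))
... | true , c =
  if-true⁺ (null (keep (covers false) st)) (λ _ → search-complete n _ c) λ _ →
  if-true⁺ (null (keep (covers true) st))
    (λ none → search-complete n _ (colour-skip true (misses false) st none c)) λ _ →
  if-true⁺ (search n (keep (misses false) st)) (λ _ → refl)
    (λ _ → search-complete n _ c)

-- Inequality constraints: correctness

Outside₁ Outside₂ : Vec Bool (2 + n) → Set
Outside₁ (a ∷ _)     = a ≡ false
Outside₂ (_ ∷ b ∷ _) = b ≡ false

Includes : Fin n → Vec Bool (2 + n) → Set
Includes u (a ∷ b ∷ r) = a ∨ b ≡ true → lookup r u ≡ true

-- Indexing all three alternatives by a user excludes rows without any user column, for which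
-- `unify` answers `false`.
Unifies : Fin n → Rows n → Set
Unifies u st = All Outside₁ st ⊎ All Outside₂ st ⊎ All (Includes u) st

unify-sound : ∀ n (st : Rows n) → unify n st ≡ true → st ≡ [] ⊎ ∃[ u ] Unifies u st
unify-sound n [] _ = inj₁ refl
unify-sound (suc n) st@((_ ∷ _ ∷ _ ∷ _) ∷ _) eq with if-true⁻ (null (keep in₁ st)) eq
... | inj₁ (none , _) =
  inj₂ (zero , inj₁ (All.map (λ { {_ ∷ _ ∷ _ ∷ _} f → f }) (null⁻ in₁ st none)))
... | inj₂ (_ , eq) with if-true⁻ (null (keep in₂ st)) eq
... | inj₁ (none , _) =
  inj₂ (zero , inj₂ (inj₁ (All.map (λ { {_ ∷ _ ∷ _ ∷ _} f → f }) (null⁻ in₂ st none))))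
... | inj₂ (_ , eq) with if-true⁻ (null (keep uncovered st)) eq
... | inj₁ (none , _) = inj₂ (zero , inj₂ (inj₂ (All.map includes (null⁻ uncovered st none))))
  where
  includes : ∀ {r} → Fails uncovered r → Includes zero r
  includes {true  ∷ _     ∷ true ∷ _} _ _ = refl
  includes {false ∷ true  ∷ true ∷ _} _ _ = refl
-- `keep any-row` of a nonempty list computes to a nonempty list, so only the second alternative can
-- come back.
... | inj₂ (_ , eq) with unify-sound n (keep any-row st) eq
... | inj₂ (u , inj₁ out) =
  inj₂ (suc u , inj₁ (keep⁻ any-row {P = Outside₁} {Outside₁} (λ f → f refl) st out))
... | inj₂ (u , inj₂ (inj₁ out)) =
  inj₂ (suc u , inj₂ (inj₁ (keep⁻ any-row {P = Outside₂} {Outside₂} (λ f → f refl) st out)))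
... | inj₂ (u , inj₂ (inj₂ inc)) =
  inj₂ (suc u , inj₂ (inj₂ (keep⁻ any-row {P = Includes u} {Includes (suc u)} (λ f → f refl) st inc)))

unify-complete : ∀ n (st : Rows n) {u} → Unifies u st → unify n st ≡ true
unify-complete n [] _ = refl
unify-complete (suc n) st@(_ ∷ _) (inj₁ out) =
  if-true⁺ (null (keep in₁ st)) (λ _ → refl)
    (λ eq → contradiction eq (not-¬ (null⁺ in₁ (All.map (λ { {_ ∷ _ ∷ _ ∷ _} f → f }) out))))
unify-complete (suc n) st@(_ ∷ _) (inj₂ (inj₁ out)) =
  if-true⁺ (null (keep in₁ st)) (λ _ → refl) λ _ →
  if-true⁺ (null (keep in₂ st)) (λ _ → refl)
    (λ eq → contradiction eq (not-¬ (null⁺ in₂ (All.map (λ { {_ ∷ _ ∷ _ ∷ _} f → f }) out))))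
unify-complete (suc n) st@(_ ∷ _) {zero} (inj₂ (inj₂ inc)) =
  if-true⁺ (null (keep in₁ st)) (λ _ → refl) λ _ →
  if-true⁺ (null (keep in₂ st)) (λ _ → refl) λ _ →
  if-true⁺ (null (keep uncovered st)) (λ _ → refl)
    (λ eq → contradiction eq (not-¬ (null⁺ uncovered (All.map fails inc))))
  where
  fails : ∀ {r} → Includes zero r → Fails uncovered r
  fails {a ∷ b ∷ x ∷ _} f with a ∨ b
  ... | false = refl
  ... | true  = cong not (f refl)
unify-complete (suc n) st@(_ ∷ _) {suc u} (inj₂ (inj₂ inc)) =
  if-true⁺ (null (keep in₁ st)) (λ _ → refl) λ _ →
  if-true⁺ (null (keep in₂ st)) (λ _ → refl) λ _ →
  if-true⁺ (null (keep uncovered st)) (λ _ → refl) λ _ →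
  unify-complete n (keep any-row st) {u}
    (inj₂ (inj₂ (keep⁺ any-row {P = Includes u} {Includes (suc u)} (λ _ f → f) inc)))

-- From rows to steps, and the relations of the constraints

table⁺ : ∀ {P : Vec Bool (2 + n) → Set} (S₁ S₂ : Subset k) (A : FinRel k n) →
         (∀ s → P (lookup S₁ s ∷ lookup S₂ s ∷ lookup A s)) → All P (table S₁ S₂ A)
table⁺ [] [] [] f = []
table⁺ (_ ∷ S₁) (_ ∷ S₂) (_ ∷ A) f = f zero ∷ table⁺ S₁ S₂ A (f ∘ suc)

table⁻ : ∀ {P : Vec Bool (2 + n) → Set} (S₁ S₂ : Subset k) (A : FinRel k n) →
         All P (table S₁ S₂ A) → ∀ s → P (lookup S₁ s ∷ lookup S₂ s ∷ lookup A s)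
table⁻ (_ ∷ S₁) (_ ∷ S₂) (_ ∷ A) (p ∷ ps) zero    = p
table⁻ (_ ∷ S₁) (_ ∷ S₂) (_ ∷ A) (p ∷ ps) (suc s) = table⁻ S₁ S₂ A ps s

true⇒∈ : ∀ {p : Subset n} {x} → lookup p x ≡ true → x ∈ p
true⇒∈ = lookup⇒[]= _ _

∉⇒false : ∀ {p : Subset n} {x} → x ∉ p → lookup p x ≡ false
∉⇒false x∉p = ¬-not (x∉p ∘ true⇒∈)

false⇒∉ : ∀ {p : Subset n} {x} → lookup p x ≡ false → x ∉ p
false⇒∉ eq x∈p = contradiction eq (not-¬ ([]=⇒lookup x∈p))

module _ {u v : Fin n} where

  diagonal⁺ : u ≡ v → u ⟪ Diagonal n ⟫ v
  diagonal⁺ refl = subst (u ∈_) (sym (lookup∘tabulate ⁅_⁆ u)) (x∈⁅x⁆ u)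

  diagonal⁻ : u ⟪ Diagonal n ⟫ v → u ≡ v
  diagonal⁻ v∈ = sym (x∈⁅y⁆⇒x≡y u (subst (v ∈_) (lookup∘tabulate ⁅_⁆ u) v∈))

  complement⁺ : ¬ u ≡ v → u ⟪ Complement (Diagonal n) ⟫ v
  complement⁺ u≢v = subst (v ∈_) (sym (lookup-map u ∁ (Diagonal n)))
    (x∉p⇒x∈∁p (u≢v ∘ diagonal⁻))

  complement⁻ : u ⟪ Complement (Diagonal n) ⟫ v → ¬ u ≡ v
  complement⁻ v∈ u≡v =
    x∈∁p⇒x∉p (subst (v ∈_) (lookup-map u ∁ (Diagonal n)) v∈) (diagonal⁺ u≡v)

∧-not⁻ : ∀ {x y} → x ∧ not y ≡ true → x ≡ true × y ≡ false
∧-not⁻ {true} {false} _ = refl , refl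

-- A user is needed to apply `unify-complete`. If there is a step, the plan supplies one; otherwise
-- the table is empty.
unify-anyone : ∀ (S₁ S₂ : Subset k) (A : FinRel k n) → Plan k n →
               (∀ u → Unifies u (table S₁ S₂ A)) → unify n (table S₁ S₂ A) ≡ true
unify-anyone []         []         []         α f = refl
unify-anyone (a ∷ S₁) (b ∷ S₂) (r ∷ A) α f =
  unify-complete _ (table (a ∷ S₁) (b ∷ S₂) (r ∷ A)) (f (α zero))

-- Plans that violate a given constraint

module _ (A : FinRel k n) where

  Authorized : Plan k n → Set
  Authorized α = ∀ s → s ⟪ A ⟫ α s

  Violable : Constraint k n → Set
  Violable c = ∃[ α ] (Authorized α × ¬ Satisfies α c)

  module _ (S₁ S₂ : Subset k) where

    -- Each step is given the user that covers it. A user shared by a step of S₁ and a step of S₂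
    -- would carry a label that one of the two rejects.
    search⇒plan : search n (table S₁ S₂ A) ≡ true → Violable ⟨ Diagonal n , S₁ , S₂ ⟩
    search⇒plan eq with ℓ , cov ← search-sound n (table S₁ S₂ A) eq =
      α , (λ s → true⇒∈ (proj₁ (∧-not⁻ (proj₂ (covered s))))) , violated
      where
      covered = table⁻ S₁ S₂ A cov

      α : Plan k n
      α s = proj₁ (covered s)

      side : ∀ s → (if lookup ℓ (α s) then lookup S₁ s else lookup S₂ s) ≡ false
      side s = proj₂ (∧-not⁻ {lookup (lookup A s) (α s)} (proj₂ (covered s)))

      disjoint : ∀ {s₁ s₂} → s₁ ∈ S₁ → s₂ ∈ S₂ → ¬ α s₁ ≡ α s₂
      disjoint {s₁} {s₂} ∈₁ ∈₂ eq with lookup ℓ (α s₁) in l | side s₁ | side s₂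
      ... | true  | out | _ = false⇒∉ out ∈₁
      ... | false | _   | out rewrite sym eq | l = false⇒∉ out ∈₂

      violated : ¬ Satisfies α ⟨ Diagonal n , S₁ , S₂ ⟩
      violated (s₁ , s₂ , ∈₁ , ∈₂ , d) = disjoint ∈₁ ∈₂ (diagonal⁻ d)

    -- The users that the plan assigns to steps of S₂ are labelled `true`, all others `false`.
    -- Violation means that no step of S₁ has a user of the first kind.
    plan⇒search : Violable ⟨ Diagonal n , S₁ , S₂ ⟩ → search n (table S₁ S₂ A) ≡ true
    plan⇒search (α , auth , violated) =
      search-complete n (table S₁ S₂ A) (ℓ , table⁺ S₁ S₂ A λ s → α s , covered s)
      where
      image? : ∀ u → Dec (∃[ s ] (s ∈ S₂ × α s ≡ u))
      image? u = any? λ s → (s ∈? S₂) ×-dec (α s ≟ u)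

      ℓ : Vec Bool n
      ℓ = Vec.tabulate (does ∘ image?)

      covered : ∀ s → covers (lookup ℓ (α s))
        (lookup S₁ s ∷ lookup S₂ s ∷ lookup (lookup A s) (α s) ∷ []) ≡ true
      covered s rewrite lookup∘tabulate (does ∘ image?) (α s) | []=⇒lookup (auth s)
        with image? (α s)
      ... | yes (t , t∈S₂ , eq) =
        cong not (∉⇒false λ s∈S₁ →
          violated (s , t , s∈S₁ , t∈S₂ , diagonal⁺ (sym eq)))
      ... | no ∄ = cong not (∉⇒false λ s∈S₂ → ∄ (s , s∈S₂ , refl))

    -- If one side is empty, every plan violates the constraint, and `authorized` yields an
    -- authorized one. Otherwise `u` performs all steps of the union, and `authorized` serves the
    -- remaining steps.
    unify⇒plan : (∀ s → Nonempty (lookup A s)) → unify n (table S₁ S₂ A) ≡ true →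
                 Violable ⟨ Complement (Diagonal n) , S₁ , S₂ ⟩
    unify⇒plan authorized eq with unify-sound n (table S₁ S₂ A) eq
    ... | inj₁ empty =
      proj₁ ∘ authorized , proj₂ ∘ authorized ,
      -- An empty table means that there are no steps, so `s₁` is absurd.
      λ (s₁ , _) → table⁻ S₁ S₂ A (subst (All (const ⊥)) (sym empty) []) s₁
    ... | inj₂ (u , inj₁ out) =
      proj₁ ∘ authorized , proj₂ ∘ authorized ,
      λ (s₁ , _ , ∈₁ , _) → false⇒∉ (table⁻ {P = Outside₁} S₁ S₂ A out s₁) ∈₁
    ... | inj₂ (u , inj₂ (inj₁ out)) =
      proj₁ ∘ authorized , proj₂ ∘ authorized ,
      λ (_ , s₂ , _ , ∈₂ , _) → false⇒∉ (table⁻ {P = Outside₂} S₁ S₂ A out s₂) ∈₂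
    ... | inj₂ (u , inj₂ (inj₂ inc)) =
      proj₁ ∘ choice , proj₁ ∘ proj₂ ∘ choice , violated
      where
      includes = table⁻ {P = Includes u} S₁ S₂ A inc

      choice : ∀ s → ∃[ v ] (v ∈ lookup A s × (lookup S₁ s ∨ lookup S₂ s ≡ true → v ≡ u))
      choice s with lookup S₁ s ∨ lookup S₂ s | includes s
      ... | true  | f = u , true⇒∈ (f refl) , λ _ → refl
      ... | false | _ = proj₁ (authorized s) , proj₂ (authorized s) , λ ()

      violated : ¬ Satisfies (proj₁ ∘ choice) ⟨ Complement (Diagonal n) , S₁ , S₂ ⟩
      violated (s₁ , s₂ , ∈₁ , ∈₂ , d) = complement⁻ d (trans
        (proj₂ (proj₂ (choice s₁)) (cong (_∨ lookup S₂ s₁) ([]=⇒lookup ∈₁)))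
        (sym (proj₂ (proj₂ (choice s₂))
          (trans (cong (lookup S₁ s₂ ∨_) ([]=⇒lookup ∈₂)) (∨-zeroʳ _)))))

    -- Equality of users is decidable, so violation forces equal users across S₁ and S₂. Two steps
    -- of S₁ are compared through a step of S₂, hence the case distinction on whether both sides are
    -- inhabited.
    plan⇒unify : Violable ⟨ Complement (Diagonal n) , S₁ , S₂ ⟩ →
                 unify n (table S₁ S₂ A) ≡ true
    plan⇒unify (α , auth , violated) with nonempty? S₁ | nonempty? S₂
    ... | yes (s₁ , ∈₁) | yes (s₂ , ∈₂) =
      unify-complete n (table S₁ S₂ A) {α s₁}
        (inj₂ (inj₂ (table⁺ {P = Includes (α s₁)} S₁ S₂ A includes)))
      where
      same : ∀ {s t} → s ∈ S₁ → t ∈ S₂ → α s ≡ α t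
      same {s} {t} s∈ t∈ = decidable-stable (α s ≟ α t) λ ≢ →
        violated (s , t , s∈ , t∈ , complement⁺ ≢)

      includes : ∀ s → lookup S₁ s ∨ lookup S₂ s ≡ true →
                 lookup (lookup A s) (α s₁) ≡ true
      includes s s∈ = subst (λ u → lookup (lookup A s) u ≡ true) (constant s∈) ([]=⇒lookup (auth s))
        where
        constant : lookup S₁ s ∨ lookup S₂ s ≡ true → α s ≡ α s₁
        constant s∈ with lookup S₁ s in in₁
        ... | true  = trans (same (true⇒∈ in₁) ∈₂) (sym (same ∈₁ ∈₂))
        ... | false = sym (same ∈₁ (true⇒∈ s∈))
    ... | no ∄ | _ = unify-anyone S₁ S₂ A α λ u →
      inj₁ (table⁺ {P = Outside₁} S₁ S₂ A λ s → ∉⇒false λ s∈ → ∄ (s , s∈))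
    ... | yes _ | no ∄ = unify-anyone S₁ S₂ A α λ u →
      inj₂ (inj₁ (table⁺ {P = Outside₂} S₁ S₂ A λ s → ∉⇒false λ s∈ → ∄ (s , s∈)))

  module _ (authorized : ∀ s → Nonempty (lookup A s)) where

    violable-correct : ∀ c form → violable A c form ≡ true ⇔ Violable c
    violable-correct ⟨ _ , S₁ , S₂ ⟩ (inj₁ refl) = mk⇔ (search⇒plan S₁ S₂) (plan⇒search S₁ S₂)
    violable-correct ⟨ _ , S₁ , S₂ ⟩ (inj₂ refl) = mk⇔ (unify⇒plan S₁ S₂ authorized) (plan⇒unify S₁ S₂)

    anyViolable⁻ : ∀ {cs : List (Constraint k n)} (forms : All EqualityOrInequality cs) →
                   anyViolable A forms ≡ true → Any Violable cs
    anyViolable⁻ (_∷_ {x = c} form forms) eq with if-true⁻ (violable A c form) eq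
    ... | inj₁ (v , _) = here (Equivalence.to (violable-correct c form) v)
    ... | inj₂ (_ , e) = there (anyViolable⁻ forms e)

    anyViolable⁺ : ∀ {cs : List (Constraint k n)} (forms : All EqualityOrInequality cs) →
                   Any Violable cs → anyViolable A forms ≡ true
    anyViolable⁺ (_∷_ {x = c} form forms) (here v) =
      if-true⁺ (violable A c form) (λ _ → refl)
        (λ eq → contradiction eq (not-¬ (Equivalence.from (violable-correct c form) v)))
    anyViolable⁺ (_∷_ {x = c} form forms) (there v) =
      if-true⁺ (violable A c form) (λ _ → refl) (λ _ → anyViolable⁺ forms v)

answer-correct : ∀ W → answer W ≡ true ⇔ ParameterizedProblem.Yes ViolatingPlan W
answer-correct W = mk⇔
  (λ eq → let α , auth , v = split (anyViolable⁻ A authorized restricted eq) in α , auth , v)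
  (λ (α , auth , v) → anyViolable⁺ A authorized restricted (Any.map (λ ¬sat → α , auth , ¬sat) v))
  where
  open EqualitySpecification W

  -- A single violated constraint suffices, so the plan found for it can be taken out of `Any`. This
  -- is what allows the constraints to be examined one at a time.
  split : ∀ {cs} → Any (Violable A) cs →
          ∃[ α ] (Authorized A α × Any (λ c → ¬ Satisfies α c) cs)
  split (here (α , auth , ¬sat)) = α , auth , here ¬sat
  split (there v) with α , auth , w ← split v = α , auth , there w

theorem15 : FPT ViolatingPlan
theorem15 = main , (λ k → 2 ^ k * suc k) , 280 , 2 , λ W →
  answer W , relax (time-bound W) (main-run W) , answer-correct W
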